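{- $\mathrm{ex}_<(n,P_5^{1432})=\Theta(n\log n)$.
   Context: Edge-ordered graph: finite simple graph with a linear order on its edges; isomorphisms preserve order; subgraphs carry induced order; $\mathrm{ex}_<(n,H)$ is the maximum number of edges of an edge-ordered graph on $n$ vertices with no subgraph isomorphic to $H$. Notation: $P_k^{a_1\dots a_{k-1}}$ is the path $v_1\dots v_k$ where edge $v_iv_{i+1}$ has label $a_i$ and edges are ordered by label. -}

module Defs where

open import Data.Nat using (ℕ; _<_)
open import Data.Fin as Fin using (Fin; toℕ)
open import Data.Fin.Patterns using (0F; 1F; 2F; 3F; 4F)
open import Data.Product using (_×_; _,_; proj₁; proj₂; Σ; ∃-syntax)
open import Data.Sum using (_⊎_)
open import Data.List using (List; length; lookup)
open import Data.List.Relation.Unary.All using (All)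
open import Data.List.Relation.Unary.Unique.Propositional using (Unique)
open import Function.Definitions using (Injective)
open import Relation.Binary.PropositionalEquality using (_≡_)
open import Relation.Nullary using (¬_)

-- An edge-ordered (finite simple) graph on vertex set Fin n.
-- Each edge {u,v} is stored once as a pair (u , v) with u < v (no loops,
-- no multi-edges by Unique); the linear order on edges is list position:
-- the edge at index i precedes the edge at index j iff i < j.
record EOGraph (n : ℕ) : Set where
  field
    edges    : List (Fin n × Fin n)
    oriented : All (λ e → proj₁ e Fin.< proj₂ e) edges
    simple   : Unique edges
open EOGraph public

∣E∣ : ∀ {n} → EOGraph n → ℕ
∣E∣ G = length (edges G)

Idx : ∀ {n} → EOGraph n → Set
Idx G = Fin (length (edges G))

EdgeAt : ∀ {n} (G : EOGraph n) → Idx G → Fin n → Fin n → Set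
EdgeAt G i a b =
  (proj₁ (lookup (edges G) i) ≡ a × proj₂ (lookup (edges G) i) ≡ b)
  ⊎ (proj₁ (lookup (edges G) i) ≡ b × proj₂ (lookup (edges G) i) ≡ a)

-- G contains a copy of P_5^{1432}: distinct vertices v1..v5 (v : Fin 5 → Fin n
-- injective; v 0F = v1, ..., v 4F = v5) and edges e1=v1v2, e2=v2v3,
-- e3=v3v4, e4=v4v5 of G with labels 1,4,3,2, i.e. in the edge order of G:
-- e1 < e4 < e3 < e2.
ContainsP5-1432 : ∀ {n} → EOGraph n → Set
ContainsP5-1432 {n} G =
  Σ (Fin 5 → Fin n) λ v → Injective _≡_ _≡_ v ×
  (∃[ i₁ ] ∃[ i₂ ] ∃[ i₃ ] ∃[ i₄ ]
     (EdgeAt G i₁ (v 0F) (v 1F) × EdgeAt G i₂ (v 1F) (v 2F) ×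
      EdgeAt G i₃ (v 2F) (v 3F) × EdgeAt G i₄ (v 3F) (v 4F) ×
      toℕ i₁ < toℕ i₄ × toℕ i₄ < toℕ i₃ × toℕ i₃ < toℕ i₂))

P5-1432-free : ∀ {n} → EOGraph n → Set
P5-1432-free G = ¬ ContainsP5-1432 G

{-# OPTIONS --safe #-}
module Submission where

-- Upper bound.  For a vertex u let ℓ(u) be the position of its third edge, and
-- for an edge i at u let b(u,i) be the edge two steps before i at u.  Each edge
-- i = uv is charged to one of its ends:
--  * if i is among the first three edges of an end, to that end;
--  * if i - ℓ(u) ≥ 2 (b(u,i) - ℓ(u)), to u; the distances i - ℓ(u) of every
--    other such edge at u at least double;
--  * otherwise, if ℓ(u) ≤ ℓ(v), to v.  For two such edges i = vu < i' = vu',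
--    avoiding the path u' → v → u (with an early edge at u' and a late edge at
--    u attached) forces b(u,i) ≤ ℓ(u'), and then 1 + ℓ(v) - ℓ(u) at least
--    halves on passing from u to u'.
-- So every vertex receives O(log n) charges.
--
-- Lower bound.  Join a < M = 2^L to M + (M + a - 2^k) for k ≤ L and order the
-- edges lexicographically.  A path whose second vertex is on the left violates
-- the lexicographic order.  Otherwise the path is a, b, c, d, e with left ends
-- a < e < c and right ends d < b.  If the edges cb and cd have exponents y and
-- z, then y < z, c - a < 2^y and c - e ≥ 2^z / 2 ≥ 2^y, contradicting a < e.

open import Defs
open import Data.Bool using (Bool; true; false)
open import Data.Fin as Fin using (Fin; zero; suc; toℕ; fromℕ<; inject≤; combine)
open import Data.Fin.Patterns using (0F; 1F; 2F; 3F)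
import Data.Fin.Properties as Fin
open import Data.List using (List; []; _∷_; length; lookup; concat; tabulate; applyDownFrom)
open import Data.List.Properties using (length-tabulate; length-applyDownFrom; length-++)
open import Data.List.Membership.Propositional.Properties using (∈-lookup)
open import Data.List.Relation.Unary.All as All using (All; []; _∷_)
import Data.List.Relation.Unary.All.Properties as All
open import Data.List.Relation.Unary.AllPairs as AllPairs using (AllPairs; []; _∷_)
import Data.List.Relation.Unary.AllPairs.Properties as AllPairs
open import Data.List.Relation.Unary.Unique.Propositional using (Unique)
open import Data.Nat using (ℕ; zero; suc; _+_; _*_; _∸_; _^_; _≤_; _<_; _≥_; z≤n; s≤s; z<s; s<s; s≤s⁻¹; s<s⁻¹; ⌊_/2⌋; _≤?_; _<?_; >-nonZero; parity)
open import Data.Nat.Induction using (<-rec)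
open import Data.Nat.Logarithm using (⌊log₂_⌋; ⌊log₂⌋-mono-≤; ⌊log₂⌊n/2⌋⌋≡⌊log₂n⌋∸1; ⌊log₂[2*b]⌋≡1+⌊log₂b⌋; ⌊log₂[2^n]⌋≡n)
open import Data.Nat.Properties
open import Data.Nat.Tactic.RingSolver using (solve-∀)
open import Data.Parity using (0ℙ; 1ℙ)
open import Data.Parity.Properties using (p≢p⁻¹; suc-homo-⁻¹)
open import Data.Product using (_×_; _,_; proj₁; proj₂; Σ; ∃-syntax)
open import Data.Sum using (_⊎_; inj₁; inj₂; swap)
open import Level using (Level)
open import Relation.Binary.Core using (Rel)
open import Relation.Binary.Definitions using (DecidableEquality; tri<; tri≈; tri>)
open import Relation.Binary.PropositionalEquality using (_≡_; _≢_; refl; sym; trans; cong; cong₂; subst; subst₂; ≢-sym)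
open import Relation.Nullary using (¬_; yes; no; does; contradiction)
open import Relation.Nullary.Decidable using (_⊎-dec_)
open import Relation.Unary using (Pred; Decidable)

-- List positions and avoiding given elements

private
  variable
    a ℓ : Level
    A : Set a

lookup-AllPairs : {R : Rel A ℓ} {xs : List A} → AllPairs R xs →
  (i j : Fin (length xs)) → i Fin.< j → R (lookup xs i) (lookup xs j)
lookup-AllPairs (Rx ∷ _)  zero    (suc j) _   = All.lookup Rx (∈-lookup j)
lookup-AllPairs (_ ∷ Rxs) (suc i) (suc j) i<j = lookup-AllPairs Rxs i j (s<s⁻¹ i<j)

Unique⇒lookup-injective : {xs : List A} → Unique xs →
  ∀ {i j} → lookup xs i ≡ lookup xs j → i ≡ j
Unique⇒lookup-injective xs! {i} {j} eq with Fin.<-cmp i j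
... | tri< i<j _ _ = contradiction eq (lookup-AllPairs xs! i j i<j)
... | tri≈ _ i≡j _ = i≡j
... | tri> _ _ j<i = contradiction (sym eq) (lookup-AllPairs xs! j i j<i)

length-concat-uniform : ∀ {q} {xss : List (List A)} →
  All (λ xs → length xs ≡ q) xss → length (concat xss) ≡ length xss * q
length-concat-uniform []                   = refl
length-concat-uniform {xss = xs ∷ _} (eq ∷ eqs) =
  trans (length-++ xs) (cong₂ _+_ eq (length-concat-uniform eqs))

avoid-one-of-two : DecidableEquality A → ∀ {x y : A} → x ≢ y →
  ∀ p → (x ≢ p) ⊎ (y ≢ p)
avoid-one-of-two _≟_ {x} {y} x≢y p with x ≟ p
... | yes refl = inj₂ (≢-sym x≢y)
... | no x≢p   = inj₁ x≢p

avoid-two-of-three : DecidableEquality A → ∀ {x y z : A} → x ≢ y → x ≢ z → y ≢ z →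
  ∀ p q → (x ≢ p × x ≢ q) ⊎ (y ≢ p × y ≢ q) ⊎ (z ≢ p × z ≢ q)
avoid-two-of-three _≟_ {x} {y} x≢y x≢z y≢z p q with x ≟ p | x ≟ q
... | no x≢p   | no x≢q = inj₁ (x≢p , x≢q)
... | yes refl | _ with avoid-one-of-two _≟_ y≢z q
...   | inj₁ y≢q = inj₂ (inj₁ (≢-sym x≢y , y≢q))
...   | inj₂ z≢q = inj₂ (inj₂ (≢-sym x≢z , z≢q))
avoid-two-of-three _≟_ {x} {y} x≢y x≢z y≢z p q | no _ | yes refl with avoid-one-of-two _≟_ y≢z p
...   | inj₁ y≢p = inj₂ (inj₁ (y≢p , ≢-sym x≢y))
...   | inj₂ z≢p = inj₂ (inj₂ (z≢p , ≢-sym x≢z))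

-- Binary logarithms

-- Doubling raises the logarithm by one. Both logarithmic counts of the upper bound rest on this:
-- positive numbers that at least double from each to the next have distinct logarithms, so only few
-- of them fit below a bound.
⌊log₂⌋-gap : ∀ {x y} → 0 < x → 2 * x ≤ y → ⌊log₂ x ⌋ ≢ ⌊log₂ y ⌋
⌊log₂⌋-gap {x} {y} 0<x 2x≤y = <⇒≢ (begin-strict
  ⌊log₂ x ⌋       <⟨ n<1+n _ ⟩
  1 + ⌊log₂ x ⌋   ≡⟨ ⌊log₂[2*b]⌋≡1+⌊log₂b⌋ x {{>-nonZero 0<x}} ⟨
  ⌊log₂ (2 * x) ⌋ ≤⟨ ⌊log₂⌋-mono-≤ 2x≤y ⟩
  ⌊log₂ y ⌋       ∎)
  where open ≤-Reasoning

n<2^[1+⌊log₂n⌋] : ∀ n → n < 2 ^ (1 + ⌊log₂ n ⌋)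
n<2^[1+⌊log₂n⌋] n = ≰⇒> λ le → 1+n≰n
  (subst (_≤ ⌊log₂ n ⌋) (⌊log₂[2^n]⌋≡n (1 + ⌊log₂ n ⌋)) (⌊log₂⌋-mono-≤ le))

2^⌊log₂n⌋≤n : ∀ n → 0 < n → 2 ^ ⌊log₂ n ⌋ ≤ n
2^⌊log₂n⌋≤n = <-rec _ go
  where
  go : ∀ n → (∀ {m} → m < n → 0 < m → 2 ^ ⌊log₂ m ⌋ ≤ m) → 0 < n → 2 ^ ⌊log₂ n ⌋ ≤ n
  go 1             rec _ = ≤-refl
  go n@(suc (suc m)) rec _ = begin
    2 ^ ⌊log₂ n ⌋                ≡⟨ cong (2 ^_) (m+[n∸m]≡n (⌊log₂⌋-mono-≤ {2} {n} (s≤s (s≤s z≤n)))) ⟨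
    2 * 2 ^ (⌊log₂ n ⌋ ∸ 1)      ≡⟨ cong (λ k → 2 * 2 ^ k) (⌊log₂⌊n/2⌋⌋≡⌊log₂n⌋∸1 n) ⟨
    2 * 2 ^ ⌊log₂ ⌊ n /2⌋ ⌋      ≤⟨ *-monoʳ-≤ 2 (rec (⌊n/2⌋<n (suc m)) z<s) ⟩
    2 * ⌊ n /2⌋                  ≡⟨ cong (⌊ n /2⌋ +_) (+-identityʳ _) ⟩
    ⌊ n /2⌋ + ⌊ n /2⌋            ≤⟨ +-monoʳ-≤ ⌊ n /2⌋ (⌊n/2⌋≤⌈n/2⌉ n) ⟩
    ⌊ n /2⌋ + _                  ≡⟨ ⌊n/2⌋+⌈n/2⌉≡n n ⟩
    n                            ∎
    where open ≤-Reasoning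

2*2^m≤2^n : ∀ {m n} → 2 ^ m < 2 ^ n → 2 * 2 ^ m ≤ 2 ^ n
2*2^m≤2^n {m} {n} lt = ^-monoʳ-≤ 2 {suc m} {n} (≰⇒> λ n≤m → <⇒≱ lt (^-monoʳ-≤ 2 {n} {m} n≤m))

-- Ranks of list positions

module Rank {A : Set a} {P : Pred A ℓ} (P? : Decidable P) where

  private
    bump : Bool → ℕ → ℕ
    bump true  = suc
    bump false = λ k → k

  -- Only entries strictly before the position are counted, so ranks start at 0.
  rank : (xs : List A) → Fin (length xs) → ℕ
  rank (x ∷ xs) zero    = 0
  rank (x ∷ xs) (suc i) = bump (does (P? x)) (rank xs i)

  -- junk if fewer than q + 1 entries of the list satisfy P
  select : List A → ℕ → ℕ
  select []       q = 0
  select (x ∷ xs) q with does (P? x) | q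
  ... | true  | zero   = 0
  ... | true  | suc q′ = suc (select xs q′)
  ... | false | q′     = suc (select xs q′)

  -- The position `i` witnesses that enough entries satisfy `P`, which keeps `select` off its junk
  -- value.
  select-spec : ∀ xs i q → q < rank xs i →
    ∃[ j ] (toℕ j ≡ select xs q × P (lookup xs j) × rank xs j ≡ q)
  select-spec (x ∷ xs) (suc i) q lt with P? x in eq | q
  ... | yes px | zero   = zero , refl , px , refl
  ... | yes px | suc q′ with select-spec xs i q′ (s<s⁻¹ lt)
  ...   | j , p , pj , r rewrite sym p = suc j , refl , pj , trans (cong (λ d → bump (does d) (rank xs j)) eq) (cong suc r)
  select-spec (x ∷ xs) (suc i) q lt | no _ | q′ with select-spec xs i q′ lt
  ...   | j , p , pj , r rewrite sym p = suc j , refl , pj , trans (cong (λ d → bump (does d) (rank xs j)) eq) r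

  rank-mono-≤ : ∀ xs {i j} → i Fin.≤ j → rank xs i ≤ rank xs j
  rank-mono-≤ (x ∷ xs) {zero}          _   = z≤n
  rank-mono-≤ (x ∷ xs) {suc i} {suc j} i≤j with does (P? x)
  ... | true  = s≤s (rank-mono-≤ xs (s≤s⁻¹ i≤j))
  ... | false = rank-mono-≤ xs (s≤s⁻¹ i≤j)

  rank-mono-< : ∀ xs {i j} → i Fin.< j → P (lookup xs i) → rank xs i < rank xs j
  rank-mono-< (x ∷ xs) {zero}  {suc j} _   pi with P? x
  ... | yes _  = z<s
  ... | no ¬px = contradiction pi ¬px
  rank-mono-< (x ∷ xs) {suc i} {suc j} i<j pi with does (P? x)
  ... | true  = s<s (rank-mono-< xs (s<s⁻¹ i<j) pi)
  ... | false = rank-mono-< xs (s<s⁻¹ i<j) pi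

  rank-cancel-< : ∀ xs {i j} → rank xs i < rank xs j → i Fin.< j
  rank-cancel-< xs lt = ≰⇒> λ j≤i → <⇒≱ lt (rank-mono-≤ xs j≤i)

  rank-cancel-≤ : ∀ xs {i j} → P (lookup xs j) → rank xs i ≤ rank xs j → i Fin.≤ j
  rank-cancel-≤ xs pj le = ≮⇒≥ λ j<i → <⇒≱ (rank-mono-< xs j<i pj) le

-- Here `u`, `u′`, `v` stand for the positions of the third edges of three vertices, and `r` for the
-- edge two steps before `i`. Failure of doubling puts `r` beyond the midpoint of `u` and `i`. As
-- `r ≤ u′ ≤ v < i`, the stretch from `u′` to `v` is less than half of the stretch from `u` to `v`.
halving : ∀ u r u′ v i → r ≤ u′ → u′ ≤ v → v < i → ¬ 2 * (r ∸ u) ≤ i ∸ u →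
  2 * suc (v ∸ u′) ≤ suc (v ∸ u)
halving u r u′ v i r≤u′ u′≤v v<i ¬le with u ≤? r
-- Truncation makes `r ∸ u` zero here, and doubling would hold trivially.
... | no u≰r = contradiction
  (subst (λ x → 2 * x ≤ i ∸ u) (sym (m≤n⇒m∸n≡0 (<⇒≤ (≰⇒> u≰r)))) z≤n) ¬le
... | yes u≤r
  -- `d`, `e`, `f` are the gaps between `u`, `r`, `u′`, `v`; the last gap, from `v` to `i`, is
  -- `1 + g`.
  with d , refl ← m≤n⇒∃[o]m+o≡n u≤r
  with e , refl ← m≤n⇒∃[o]m+o≡n r≤u′
  with f , refl ← m≤n⇒∃[o]m+o≡n u′≤v
  with g , refl ← m≤n⇒∃[o]m+o≡n v<i = begin
    2 * suc (u + d + e + f ∸ (u + d + e))   ≡⟨ cong (λ x → 2 * suc x) (m+n∸m≡n (u + d + e) f) ⟩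
    2 * suc f                               ≤⟨ m≤m+n _ (e + g) ⟩
    2 * suc f + (e + g)                     ≡⟨ i₁ e f g ⟩
    2 + (e + f + g) + f                     ≤⟨ +-monoˡ-≤ f small ⟩
    d + f                                   ≤⟨ +-monoˡ-≤ f (m≤m+n d e) ⟩
    d + e + f                               ≤⟨ n≤1+n _ ⟩
    suc (d + e + f)                         ≡⟨ cong suc (trans (cong (_∸ u) (i₂ u d e f)) (m+n∸m≡n u _)) ⟨
    suc (u + d + e + f ∸ u)                 ∎
  where
  open ≤-Reasoning
  i₁ : ∀ e f g → 2 * suc f + (e + g) ≡ 2 + (e + f + g) + f
  i₁ = solve-∀
  i₂ : ∀ u d e f → u + d + e + f ≡ u + (d + e + f)
  i₂ = solve-∀
  i₃ : ∀ u d e f g → suc (u + d + e + f) + g ≡ u + (1 + (d + e + f + g))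
  i₃ = solve-∀
  i₄ : ∀ d e f g → d + (2 + (e + f + g)) ≡ suc (1 + (d + e + f + g))
  i₄ = solve-∀
  -- Failure of doubling reads `1 + (d + e + f + g) < 2 * d`; one `d` cancels.
  small : 2 + (e + f + g) ≤ d
  small = +-cancelˡ-≤ d _ _ (begin
    d + (2 + (e + f + g))                 ≡⟨ i₄ d e f g ⟩
    suc (1 + (d + e + f + g))             ≡⟨ cong suc (trans (cong (_∸ u) (i₃ u d e f g)) (m+n∸m≡n u _)) ⟨
    suc (suc (u + d + e + f) + g ∸ u)     ≤⟨ ≰⇒> ¬le ⟩
    2 * (u + d ∸ u)                       ≡⟨ cong (2 *_) (m+n∸m≡n u d) ⟩
    2 * d                                 ≡⟨ cong (d +_) (+-identityʳ d) ⟩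
    d + d                                 ∎)

-- The upper bound

module _ {n} (G : EOGraph n) where

  edgeAt-sym : ∀ {i u w} → EdgeAt G i u w → EdgeAt G i w u
  edgeAt-sym = swap

  edge-oriented : ∀ i → proj₁ (lookup (edges G) i) Fin.< proj₂ (lookup (edges G) i)
  edge-oriented i = All.lookup (oriented G) (∈-lookup i)

  edgeAt-irrefl : ∀ {i u w} → EdgeAt G i u w → u ≢ w
  edgeAt-irrefl {i} (inj₁ (refl , refl)) eq = <⇒≢ (edge-oriented i) (cong toℕ eq)
  edgeAt-irrefl {i} (inj₂ (refl , refl)) eq = <⇒≢ (edge-oriented i) (cong toℕ (sym eq))

  edgeAt-unique : ∀ {i j u w} → EdgeAt G i u w → EdgeAt G j u w → i ≡ j
  edgeAt-unique (inj₁ (p , q)) (inj₁ (p′ , q′)) =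
    Unique⇒lookup-injective (simple G) (cong₂ _,_ (trans p (sym p′)) (trans q (sym q′)))
  edgeAt-unique (inj₂ (p , q)) (inj₂ (p′ , q′)) =
    Unique⇒lookup-injective (simple G) (cong₂ _,_ (trans p (sym p′)) (trans q (sym q′)))
  edgeAt-unique {i} {j} (inj₁ (refl , refl)) (inj₂ (p′ , q′)) =
    contradiction (edge-oriented j) (<-asym (subst₂ Fin._<_ (sym q′) (sym p′) (edge-oriented i)))
  edgeAt-unique {i} {j} (inj₂ (refl , refl)) (inj₁ (p′ , q′)) =
    contradiction (edge-oriented j) (<-asym (subst₂ Fin._<_ (sym q′) (sym p′) (edge-oriented i)))

  -- A crude bound, there to turn logarithms of edge positions into O(log n).
  ∣E∣≤n*n : ∣E∣ G ≤ n * n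
  ∣E∣≤n*n = Fin.injective⇒≤ {f = λ i → combine (proj₁ (lookup (edges G) i)) (proj₂ (lookup (edges G) i))}
    λ eq → let p , q = Fin.combine-injective _ _ _ _ eq in
    Unique⇒lookup-injective (simple G) (cong₂ _,_ p q)

  path⇒contains : ∀ {v₁ v₂ v₃ v₄ v₅ i₁ i₂ i₃ i₄} → Unique (v₁ ∷ v₂ ∷ v₃ ∷ v₄ ∷ v₅ ∷ []) →
    EdgeAt G i₁ v₁ v₂ → EdgeAt G i₂ v₂ v₃ → EdgeAt G i₃ v₃ v₄ → EdgeAt G i₄ v₄ v₅ →
    i₁ Fin.< i₄ → i₄ Fin.< i₃ → i₃ Fin.< i₂ → ContainsP5-1432 G
  path⇒contains {v₁} {v₂} {v₃} {v₄} {v₅} vs! e₁ e₂ e₃ e₄ 1<4 4<3 3<2 =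
    lookup (v₁ ∷ v₂ ∷ v₃ ∷ v₄ ∷ v₅ ∷ []) , Unique⇒lookup-injective vs! , _ , _ , _ , _ , e₁ , e₂ , e₃ , e₄ , 1<4 , 4<3 , 3<2

  -- Ranks of edges at a vertex

  Incident : Fin n → Pred (Fin n × Fin n) _
  Incident u e = proj₁ e ≡ u ⊎ proj₂ e ≡ u

  incident? : ∀ u → Decidable (Incident u)
  incident? u e = (proj₁ e Fin.≟ u) ⊎-dec (proj₂ e Fin.≟ u)

  module R (u : Fin n) = Rank (incident? u)

  edgeAt⇒incident : ∀ {i u w} → EdgeAt G i u w → Incident u (lookup (edges G) i)
  edgeAt⇒incident (inj₁ (p , _)) = inj₁ p
  edgeAt⇒incident (inj₂ (_ , q)) = inj₂ q

  incident⇒edgeAt : ∀ {i u} → Incident u (lookup (edges G) i) → ∃[ w ] EdgeAt G i u w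
  incident⇒edgeAt (inj₁ p) = _ , inj₁ (p , refl)
  incident⇒edgeAt (inj₂ q) = _ , inj₂ (refl , q)

  rank : Fin n → Idx G → ℕ
  rank u i = R.rank u (edges G) i

  -- Rank 2 belongs to the third edge. The value is meaningful as soon as some `i` has
  -- `3 ≤ rank u i`.
  third : Fin n → ℕ
  third u = R.select u (edges G) 2

  back : Fin n → Idx G → ℕ
  back u i = R.select u (edges G) (rank u i ∸ 2)

  edgeOfRank : ∀ u i q → q < rank u i →
    ∃[ j ] ∃[ w ] (EdgeAt G j u w × toℕ j ≡ R.select u (edges G) q × rank u j ≡ q)
  edgeOfRank u i q lt with R.select-spec u (edges G) i q lt
  ... | j , eq , inc , r = j , proj₁ (incident⇒edgeAt inc) , proj₂ (incident⇒edgeAt inc) , eq , r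

  rank-injective : ∀ {u i j w w′} → EdgeAt G i u w → EdgeAt G j u w′ → rank u i ≡ rank u j → i ≡ j
  rank-injective {u} ei ej eq = Fin.toℕ-injective (≤-antisym
    (R.rank-cancel-≤ u (edges G) (edgeAt⇒incident ej) (≤-reflexive eq))
    (R.rank-cancel-≤ u (edges G) (edgeAt⇒incident ei) (≤-reflexive (sym eq))))

  rank≢⇒end≢ : ∀ {u i j w w′} → EdgeAt G i u w → EdgeAt G j u w′ → rank u i ≢ rank u j → w ≢ w′
  rank≢⇒end≢ ei ej r≢ refl = r≢ (cong (rank _) (edgeAt-unique ei ej))

  third< : ∀ {u i} → 3 ≤ rank u i → third u < toℕ i
  third< {u} {i} 3≤ with edgeOfRank u i 2 3≤
  ... | j , _ , _ , eq , r = subst (_< toℕ i) eq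
    (R.rank-cancel-< u (edges G) (subst (_< rank u i) (sym r) 3≤))

  ≤third : ∀ {u i j} → 3 ≤ rank u i → rank u j ≤ 2 → toℕ j ≤ third u
  ≤third {u} {i} {j} 3≤ le with edgeOfRank u i 2 3≤
  ... | _ , _ , e , eq , r = subst (toℕ j ≤_) eq
    (R.rank-cancel-≤ u (edges G) (edgeAt⇒incident e) (subst (rank u j ≤_) (sym r) le))

  ≤back : ∀ {u i j} → 3 ≤ rank u i → 2 + rank u j ≤ rank u i → toℕ j ≤ back u i
  ≤back {u} {i} {j} 3≤ le
    with edgeOfRank u i (rank u i ∸ 2) (∸-monoʳ-< {rank u i} {2} z<s (≤-trans (n≤1+n 2) 3≤))
  ... | _ , _ , e , eq , r = subst (toℕ j ≤_) eq
    (R.rank-cancel-≤ u (edges G) (edgeAt⇒incident e) (subst (rank u j ≤_) (sym r) (∸-monoˡ-≤ 2 le)))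

  -- The first three edges at `u` have distinct other ends, so one of these misses both `p` and `q`.
  -- Two forbidden vertices are the reason for the threshold three.
  earlyEdge : ∀ {u i} → 3 ≤ rank u i → ∀ p q →
    ∃[ j ] ∃[ w ] (EdgeAt G j u w × rank u j ≤ 2 × w ≢ p × w ≢ q)
  earlyEdge {u} {i} 3≤ p q
    with edgeOfRank u i 0 (≤-trans (s≤s z≤n) 3≤) | edgeOfRank u i 1 (≤-trans (s≤s (s≤s z≤n)) 3≤) | edgeOfRank u i 2 3≤
  ... | _ , _ , e₀ , _ , r₀ | _ , _ , e₁ , _ , r₁ | _ , _ , e₂ , _ , r₂
    with avoid-two-of-three Fin._≟_
      (rank≢⇒end≢ e₀ e₁ (λ eq → 0≢1+n (trans (sym r₀) (trans eq r₁))))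
      (rank≢⇒end≢ e₀ e₂ (λ eq → 0≢1+n (trans (sym r₀) (trans eq r₂))))
      (rank≢⇒end≢ e₁ e₂ (λ eq → 0≢1+n (suc-injective (trans (sym r₁) (trans eq r₂)))))
      p q
  ... | inj₁ ≢pq        = _ , _ , e₀ , ≤-trans (≤-reflexive r₀) z≤n , ≢pq
  ... | inj₂ (inj₁ ≢pq) = _ , _ , e₁ , ≤-trans (≤-reflexive r₁) (s≤s z≤n) , ≢pq
  ... | inj₂ (inj₂ ≢pq) = _ , _ , e₂ , ≤-reflexive r₂ , ≢pq

  -- The two edges at `u` just before `i` have distinct other ends, so one of these misses `p`. One
  -- forbidden vertex is the reason why `back` goes two steps.
  lateEdge : ∀ {u i} → 3 ≤ rank u i → ∀ p →
    ∃[ j ] ∃[ w ] (EdgeAt G j u w × back u i ≤ toℕ j × j Fin.< i × w ≢ p)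
  lateEdge {u} {i} 3≤ p
    with edgeOfRank u i (rank u i ∸ 2) (∸-monoʳ-< {rank u i} {2} z<s (≤-trans (n≤1+n 2) 3≤))
       | edgeOfRank u i (rank u i ∸ 1) (∸-monoʳ-< {rank u i} {1} z<s (≤-trans (s≤s z≤n) 3≤))
  ... | j₂ , _ , e₂ , s₂ , r₂ | j₁ , _ , e₁ , _ , r₁
    with avoid-one-of-two Fin._≟_ (rank≢⇒end≢ e₂ e₁ (<⇒≢ r₂<r₁)) p
    where
    r₂<r₁ : rank u j₂ < rank u j₁
    r₂<r₁ = subst₂ _<_ (sym r₂) (sym r₁) (∸-monoʳ-< {rank u i} {2} {1} (s<s z<s) (≤-trans (n≤1+n 2) 3≤))
  ... | inj₁ ≢p = _ , _ , e₂ , ≤-reflexive (sym s₂) , before , ≢p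
    where
    before : j₂ Fin.< i
    before = R.rank-cancel-< u (edges G)
      (subst (_< rank u i) (sym r₂) (∸-monoʳ-< {rank u i} {2} z<s (≤-trans (n≤1+n 2) 3≤)))
  ... | inj₂ ≢p = _ , _ , e₁ , after , before , ≢p
    where
    before : j₁ Fin.< i
    before = R.rank-cancel-< u (edges G)
      (subst (_< rank u i) (sym r₁) (∸-monoʳ-< {rank u i} {1} z<s (≤-trans (s≤s z≤n) 3≤)))
    after : back u i ≤ toℕ j₁
    after = subst (_≤ toℕ j₁) s₂ (R.rank-cancel-≤ u (edges G) (edgeAt⇒incident e₁)
      (subst₂ _≤_ (sym r₂) (sym r₁) (∸-monoʳ-≤ (rank u i) (n≤1+n 1))))

  -- Otherwise `y`, `u′`, `v`, `u`, `x` is a forbidden path, where `k` is an early edge from `u′` to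
  -- `y` and `j` a late edge from `u` to `x`: then `k ≤ third u′ < back u i ≤ j < i < i′`.
  back≤third : P5-1432-free G → ∀ {i i′ v u u′} → EdgeAt G i v u → EdgeAt G i′ v u′ → i Fin.< i′ →
    3 ≤ rank u i → 3 ≤ rank u′ i′ → back u i ≤ third u′
  back≤third free {i} {i′} {v} {u} {u′} e e′ i<i′ 3≤ 3≤′ = ≮⇒≥ λ third<back →
    let
      u≢u′ : u ≢ u′
      u≢u′ = λ { refl → <⇒≢ i<i′ (cong toℕ (edgeAt-unique e e′)) }
      -- The late edge is chosen first, because the early edge has to avoid its end `x`.
      j , x , ej , back≤j , j<i , x≢u′ = lateEdge {u} {i} 3≤ u′
      k , y , ek , rk≤2 , y≢u , y≢x = earlyEdge {u′} {i′} 3≤′ u x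
      -- The vertex `v` is avoided automatically: `j` precedes `i`, the only edge joining `u` and
      -- `v`, and `k` has a smaller rank at `u′` than `i′`.
      v≢x : v ≢ x
      v≢x = λ { refl → <⇒≢ j<i (cong toℕ (edgeAt-unique ej (edgeAt-sym e))) }
      y≢v : y ≢ v
      y≢v = rank≢⇒end≢ ek (edgeAt-sym e′) (<⇒≢ (≤-trans (s≤s rk≤2) 3≤′))
      distinct = (≢-sym (edgeAt-irrefl ek) ∷ y≢v ∷ y≢u ∷ y≢x ∷ [])
               ∷ (≢-sym (edgeAt-irrefl e′) ∷ ≢-sym u≢u′ ∷ ≢-sym x≢u′ ∷ [])
               ∷ (edgeAt-irrefl e ∷ v≢x ∷ [])
               ∷ (edgeAt-irrefl ej ∷ [])
               ∷ [] ∷ []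
    in free (path⇒contains distinct (edgeAt-sym ek) (edgeAt-sym e′) e ej
      (≤-<-trans (≤third {u′} {i′} 3≤′ rk≤2) (<-≤-trans third<back back≤j)) j<i i<i′)

  -- The charging scheme

  Doubling : Fin n → Idx G → Set
  Doubling u i = 2 * (back u i ∸ third u) ≤ toℕ i ∸ third u

  -- The indices after `v` are the kind of the charge and its slot; together with `v` they determine
  -- `i`. Doubling compares edges two ranks apart, hence the split by parity. The slot is given by
  -- an equation, so that matching two charges does not have to unify logarithms.
  data Charge (i : Idx G) (v : Fin n) : Fin 4 → ℕ → Set where
    early   : ∀ {w x} → EdgeAt G i v w → x ≡ rank v i → rank v i < 3 → Charge i v 0F x
    double₀ : ∀ {w x} → EdgeAt G i v w → x ≡ ⌊log₂ (toℕ i ∸ third v) ⌋ → 3 ≤ rank v i →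
              Doubling v i → parity (rank v i) ≡ 0ℙ → Charge i v 1F x
    double₁ : ∀ {w x} → EdgeAt G i v w → x ≡ ⌊log₂ (toℕ i ∸ third v) ⌋ → 3 ≤ rank v i →
              Doubling v i → parity (rank v i) ≡ 1ℙ → Charge i v 2F x
    halve   : ∀ {u x} → EdgeAt G i v u → x ≡ ⌊log₂ suc (third v ∸ third u) ⌋ →
              3 ≤ rank v i → 3 ≤ rank u i → third u ≤ third v → ¬ Doubling u i → Charge i v 3F x

  -- Ranks of equal parity differ by at least two, so `i` is no later than `back v i′`, and doubling
  -- at `i′` at least doubles the distance from `third v`.
  double-distinct : ∀ {i i′ v w w′} → EdgeAt G i v w → EdgeAt G i′ v w′ → i Fin.< i′ →
    3 ≤ rank v i → 3 ≤ rank v i′ → Doubling v i′ → parity (rank v i) ≡ parity (rank v i′) →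
    ⌊log₂ (toℕ i ∸ third v) ⌋ ≢ ⌊log₂ (toℕ i′ ∸ third v) ⌋
  double-distinct {i} {i′} {v} e e′ i<i′ 3≤ 3≤′ dbl par = ⌊log₂⌋-gap
    (m<n⇒0<n∸m (third< {v} {i} 3≤))
    (≤-trans (*-monoʳ-≤ 2 (∸-monoˡ-≤ (third v) (≤back {v} {i′} {i} 3≤′ gap))) dbl)
    where
    gap : 2 + rank v i ≤ rank v i′
    gap = ≤∧≢⇒< (R.rank-mono-< v (edges G) i<i′ (edgeAt⇒incident e))
      λ eq → p≢p⁻¹ (parity (rank v i)) (trans par (trans (cong parity (sym eq)) (sym (suc-homo-⁻¹ (suc (rank v i))))))

  -- Avoiding the path gives `back u i ≤ third u′`, which is what `halving` asks for. The `suc`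
  -- keeps the arguments of the logarithms positive when third edges have equal positions.
  halve-distinct : P5-1432-free G → ∀ {i i′ v u u′} → EdgeAt G i v u → EdgeAt G i′ v u′ → i Fin.< i′ →
    3 ≤ rank v i → 3 ≤ rank u i → 3 ≤ rank u′ i′ → third u′ ≤ third v → ¬ Doubling u i →
    ⌊log₂ suc (third v ∸ third u′) ⌋ ≢ ⌊log₂ suc (third v ∸ third u) ⌋
  halve-distinct free {i} {i′} {v} {u} {u′} e e′ i<i′ 3≤v 3≤u 3≤u′ u′≤v ¬dbl = ⌊log₂⌋-gap z<s
    (halving (third u) (back u i) (third u′) (third v) (toℕ i)
      (back≤third free e e′ i<i′ 3≤u 3≤u′) u′≤v (third< {v} {i} 3≤v) ¬dbl)

  charge-distinct : P5-1432-free G → ∀ {i i′ v t x} → Charge i v t x → Charge i′ v t x → ¬ i Fin.< i′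
  charge-distinct free (early e refl _) (early e′ eq _) i<i′ =
    <⇒≢ i<i′ (cong toℕ (rank-injective e e′ eq))
  charge-distinct free (double₀ e refl 3≤ _ p) (double₀ e′ eq 3≤′ dbl p′) i<i′ =
    double-distinct e e′ i<i′ 3≤ 3≤′ dbl (trans p (sym p′)) eq
  charge-distinct free (double₁ e refl 3≤ _ p) (double₁ e′ eq 3≤′ dbl p′) i<i′ =
    double-distinct e e′ i<i′ 3≤ 3≤′ dbl (trans p (sym p′)) eq
  charge-distinct free (halve e refl 3≤v 3≤u _ ¬dbl) (halve e′ eq _ 3≤u′ u′≤v _) i<i′ =
    halve-distinct free e e′ i<i′ 3≤v 3≤u 3≤u′ u′≤v ¬dbl (sym eq)

  charge-injective : P5-1432-free G → ∀ {i i′ v t x} → Charge i v t x → Charge i′ v t x → i ≡ i′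
  charge-injective free {i} {i′} c c′ with Fin.<-cmp i i′
  ... | tri< i<i′ _ _ = contradiction i<i′ (charge-distinct free c c′)
  ... | tri≈ _ i≡i′ _ = i≡i′
  ... | tri> _ _ i′<i = contradiction i′<i (charge-distinct free c′ c)

  -- Early charges use 0, 1, 2; all others use logarithms of numbers at most `∣E∣ G`.
  slots : ℕ
  slots = 3 + ⌊log₂ ∣E∣ G ⌋

  Charged : Idx G → Set
  Charged i = ∃[ v ] ∃[ t ] ∃[ x ] (Charge i v t x × x < slots)

  ⌊log₂⌋<slots : ∀ {x} → x ≤ ∣E∣ G → ⌊log₂ x ⌋ < slots
  ⌊log₂⌋<slots le = ≤-<-trans (⌊log₂⌋-mono-≤ le) (s≤s (m≤n+m _ 2))

  chargeDouble : ∀ {i v w} → EdgeAt G i v w → 3 ≤ rank v i → Doubling v i → Charged i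
  chargeDouble {i} {v} e 3≤ dbl with parity (rank v i) in p
  ... | 0ℙ = v , 1F , _ , double₀ e refl 3≤ dbl p , ⌊log₂⌋<slots (≤-trans (m∸n≤m _ (third v)) (<⇒≤ (Fin.toℕ<n i)))
  ... | 1ℙ = v , 2F , _ , double₁ e refl 3≤ dbl p , ⌊log₂⌋<slots (≤-trans (m∸n≤m _ (third v)) (<⇒≤ (Fin.toℕ<n i)))

  chargeHalve : ∀ {i v u} → EdgeAt G i v u → 3 ≤ rank v i → 3 ≤ rank u i → third u ≤ third v →
    ¬ Doubling u i → Charged i
  chargeHalve {i} {v} {u} e 3≤v 3≤u u≤v ¬dbl = v , 3F , _ , halve e refl 3≤v 3≤u u≤v ¬dbl ,
    ⌊log₂⌋<slots (≤-trans (s≤s (m∸n≤m _ (third u))) (≤-trans (third< {v} {i} 3≤v) (<⇒≤ (Fin.toℕ<n i))))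

  charge : ∀ {i u v} → EdgeAt G i u v → Charged i
  charge {i} {u} {v} e with 3 ≤? rank u i | 3 ≤? rank v i
  ... | no ≰   | _      = u , 0F , _ , early e refl (≰⇒> ≰) , ≤-trans (≰⇒> ≰) (m≤m+n 3 _)
  ... | yes _  | no ≰   = v , 0F , _ , early (edgeAt-sym e) refl (≰⇒> ≰) , ≤-trans (≰⇒> ≰) (m≤m+n 3 _)
  ... | yes 3≤u | yes 3≤v
    with 2 * (back u i ∸ third u) ≤? toℕ i ∸ third u | 2 * (back v i ∸ third v) ≤? toℕ i ∸ third v
  ...   | yes dbl | _       = chargeDouble e 3≤u dbl
  ...   | no _    | yes dbl = chargeDouble (edgeAt-sym e) 3≤v dbl
  -- Doubling fails at both ends; the charge goes to the end whose third edge is later.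
  ...   | no ¬u   | no ¬v with ≤-total (third u) (third v)
  ...     | inj₁ u≤v = chargeHalve (edgeAt-sym e) 3≤v 3≤u u≤v ¬u
  ...     | inj₂ v≤u = chargeHalve e 3≤u 3≤v v≤u ¬v

  ∣E∣≤n*4*slots : P5-1432-free G → ∣E∣ G ≤ n * (4 * slots)
  ∣E∣≤n*4*slots free = Fin.injective⇒≤ {f = code} code-injective
    where
    charged : ∀ i → Charged i
    charged i = charge {i} (inj₁ (refl , refl))
    code : Idx G → Fin (n * (4 * slots))
    code i = let v , t , x , _ , x< = charged i in combine v (combine t (fromℕ< x<))
    code-injective : ∀ {i i′} → code i ≡ code i′ → i ≡ i′
    code-injective {i} {i′} eq with charged i | charged i′
    ... | v , t , x , c , x< | v′ , t′ , x′ , c′ , x′<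
      with Fin.combine-injective v (combine t (fromℕ< x<)) v′ (combine t′ (fromℕ< x′<)) eq
    ... | refl , eq′ with Fin.combine-injective t (fromℕ< x<) t′ (fromℕ< x′<) eq′
    ... | refl , eq″ with Fin.fromℕ<-injective x x′ x< x′< eq″
    ... | refl = charge-injective free c c′

upper-bound : ∀ n → 4 ≤ n → (G : EOGraph n) → P5-1432-free G → ∣E∣ G ≤ 28 * (n * ⌊log₂ n ⌋)
upper-bound n 4≤n G free = begin
  ∣E∣ G                                   ≤⟨ ∣E∣≤n*4*slots G free ⟩
  n * (4 * (3 + ⌊log₂ ∣E∣ G ⌋))           ≤⟨ *-monoʳ-≤ n (*-monoʳ-≤ 4 (+-monoʳ-≤ 3 log-bound)) ⟩
  n * (4 * (3 + (1 + k + (1 + k))))       ≡⟨ cong (n *_) (regroup k) ⟩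
  -- Since `1 ≤ k`, the constant 20 is absorbed into `20 * k`, whence 28 = 20 + 8.
  n * (20 * 1 + 8 * k)                    ≤⟨ *-monoʳ-≤ n (+-monoˡ-≤ (8 * k) (*-monoʳ-≤ 20 1≤k)) ⟩
  n * (20 * k + 8 * k)                    ≡⟨ collect n k ⟩
  28 * (n * k)                            ∎
  where
  open ≤-Reasoning
  k = ⌊log₂ n ⌋
  1≤k : 1 ≤ k
  1≤k = ⌊log₂⌋-mono-≤ {2} (≤-trans (s≤s (s≤s z≤n)) 4≤n)
  n≤ : n ≤ 2 ^ (1 + k)
  n≤ = <⇒≤ (n<2^[1+⌊log₂n⌋] n)
  log-bound : ⌊log₂ ∣E∣ G ⌋ ≤ 1 + k + (1 + k)
  log-bound = begin
    ⌊log₂ ∣E∣ G ⌋                       ≤⟨ ⌊log₂⌋-mono-≤ (∣E∣≤n*n G) ⟩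
    ⌊log₂ n * n ⌋                       ≤⟨ ⌊log₂⌋-mono-≤ (*-mono-≤ n≤ n≤) ⟩
    ⌊log₂ 2 ^ (1 + k) * 2 ^ (1 + k) ⌋   ≡⟨ cong ⌊log₂_⌋ (^-distribˡ-+-* 2 (1 + k) (1 + k)) ⟨
    ⌊log₂ 2 ^ (1 + k + (1 + k)) ⌋       ≡⟨ ⌊log₂[2^n]⌋≡n _ ⟩
    1 + k + (1 + k)                     ∎
  regroup : ∀ k → 4 * (3 + (1 + k + (1 + k))) ≡ 20 * 1 + 8 * k
  regroup = solve-∀
  collect : ∀ n k → n * (20 * k + 8 * k) ≡ 28 * (n * k)
  collect = solve-∀

-- The lower bound

module Construction (n L : ℕ) (3M≤n : 2 ^ L + 2 ^ L + 2 ^ L ≤ n) where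

  M : ℕ
  M = 2 ^ L

  M≤n : M ≤ n
  M≤n = ≤-trans (m≤n+m M (M + M)) 3M≤n

  right<n : ∀ (a : Fin M) k → M + M + toℕ a ∸ 2 ^ k < n
  right<n a k = ≤-<-trans (m∸n≤m _ (2 ^ k)) (<-≤-trans (+-monoʳ-< (M + M) (Fin.toℕ<n a)) 3M≤n)

  edge : Fin M → ℕ → Fin n × Fin n
  edge a k = inject≤ a M≤n , fromℕ< (right<n a k)

  -- Exponents run downwards from `L` to 0, so that right ends increase along the row.
  row : Fin M → List (Fin n × Fin n)
  row a = applyDownFrom (edge a) (suc L)

  edgeList : List (Fin n × Fin n)
  edgeList = concat (tabulate row)

  -- The formula for the right end is stated additively, free of truncated subtraction.
  record IsEdge (e : Fin n × Fin n) : Set where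
    field
      left     : toℕ (proj₁ e) < M
      right    : M ≤ toℕ (proj₂ e)
      exponent : ℕ
      equation : toℕ (proj₂ e) + 2 ^ exponent ≡ M + M + toℕ (proj₁ e)
  open IsEdge

  2^k≤M : ∀ {k} → k < suc L → 2 ^ k ≤ M
  2^k≤M k<1+L = ^-monoʳ-≤ 2 (s≤s⁻¹ k<1+L)

  edge-isEdge : ∀ a {k} → k < suc L → IsEdge (edge a k)
  edge-isEdge a {k} k<1+L = record
    { left     = subst (_< M) (sym (Fin.toℕ-inject≤ a M≤n)) (Fin.toℕ<n a)
    ; right    = subst (M ≤_) (sym (Fin.toℕ-fromℕ< (right<n a k))) (begin
        M                          ≡⟨ m+n∸m≡n M M ⟨
        M + M ∸ M                  ≤⟨ ∸-mono (m≤m+n (M + M) (toℕ a)) (2^k≤M k<1+L) ⟩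
        M + M + toℕ a ∸ 2 ^ k      ∎)
    ; exponent = k
    ; equation = trans (cong (_+ 2 ^ k) (Fin.toℕ-fromℕ< (right<n a k)))
        (trans (m∸n+n≡m (2^k≤2M+a k<1+L)) (cong (M + M +_) (sym (Fin.toℕ-inject≤ a M≤n))))
    }
    where
    open ≤-Reasoning
    2^k≤2M+a : k < suc L → 2 ^ k ≤ M + M + toℕ a
    2^k≤2M+a lt = ≤-trans (2^k≤M lt) (≤-trans (m≤m+n M M) (m≤m+n (M + M) (toℕ a)))

  _≺_ : Rel (Fin n × Fin n) _
  e ≺ f = proj₁ e Fin.< proj₁ f ⊎ (proj₁ e ≡ proj₁ f × proj₂ e Fin.< proj₂ f)

  row-sorted : ∀ a → AllPairs _≺_ (row a)
  row-sorted a = AllPairs.applyDownFrom⁺₁ (edge a) (suc L) λ {i} {j} j<i i<1+L → inj₂ (refl ,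
    subst₂ _<_ (sym (Fin.toℕ-fromℕ< (right<n a i))) (sym (Fin.toℕ-fromℕ< (right<n a j)))
      (∸-monoʳ-< (^-monoʳ-< 2 (s<s z<s) j<i)
        (≤-trans (2^k≤M i<1+L) (≤-trans (m≤m+n M M) (m≤m+n (M + M) (toℕ a))))))

  rows-sorted : ∀ {a b} → a Fin.< b → All (λ e → All (e ≺_) (row b)) (row a)
  rows-sorted {a} {b} a<b = All.applyDownFrom⁺₂ (edge a) (suc L) λ i →
    All.applyDownFrom⁺₂ (edge b) (suc L) λ j →
    inj₁ (subst₂ _<_ (sym (Fin.toℕ-inject≤ a M≤n)) (sym (Fin.toℕ-inject≤ b M≤n)) a<b)

  -- Yields both the simplicity of the graph and the translation of list positions into `_≺_`.
  sorted : AllPairs _≺_ edgeList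
  sorted = AllPairs.concat⁺ (All.tabulate⁺ row-sorted) (AllPairs.tabulate⁺-< rows-sorted)

  allIsEdge : All IsEdge edgeList
  allIsEdge = All.concat⁺ (All.tabulate⁺ λ a →
    All.applyDownFrom⁺₁ (edge a) (suc L) (edge-isEdge a))

  ≺⇒≢ : ∀ {e f} → e ≺ f → e ≢ f
  ≺⇒≢ (inj₁ lt)       eq = <⇒≢ lt (cong (λ e → toℕ (proj₁ e)) eq)
  ≺⇒≢ (inj₂ (_ , lt)) eq = <⇒≢ lt (cong (λ e → toℕ (proj₂ e)) eq)

  ≺⇒≤ : ∀ {e f} → e ≺ f → toℕ (proj₁ e) ≤ toℕ (proj₁ f)
  ≺⇒≤ (inj₁ lt)       = <⇒≤ lt
  ≺⇒≤ (inj₂ (eq , _)) = ≤-reflexive (cong toℕ eq)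

  graph : EOGraph n
  graph = record
    { edges    = edgeList
    ; oriented = All.map (λ e → <-≤-trans (left e) (right e)) allIsEdge
    ; simple   = AllPairs.map ≺⇒≢ sorted
    }

  ∣E∣-graph : ∣E∣ graph ≡ M * suc L
  ∣E∣-graph = trans (length-concat-uniform (All.tabulate⁺ λ a → length-applyDownFrom (edge a) (suc L)))
    (cong (_* suc L) (length-tabulate row))

  isEdge : ∀ i → IsEdge (lookup edgeList i)
  isEdge i = All.lookup allIsEdge (∈-lookup i)

  -- Every edge joins a vertex below `M` to one that is not, so the side of `x` decides in which
  -- direction the edge is stored.
  pairAt : ∀ {i x y} → EdgeAt graph i x y → toℕ x < M → lookup edgeList i ≡ (x , y)
  pairAt (inj₁ (p , q)) x<M = cong₂ _,_ p q
  pairAt {i} (inj₂ (p , q)) x<M = contradiction (subst (λ z → M ≤ toℕ z) q (right (isEdge i))) (<⇒≱ x<M)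

  pairAt′ : ∀ {i x y} → EdgeAt graph i x y → M ≤ toℕ x → lookup edgeList i ≡ (y , x)
  pairAt′ (inj₂ (p , q)) M≤x = cong₂ _,_ p q
  pairAt′ {i} (inj₁ (p , q)) M≤x = contradiction (subst (λ z → toℕ z < M) p (left (isEdge i))) (≤⇒≯ M≤x)

  ordered : ∀ {i j e f} → lookup edgeList i ≡ e → lookup edgeList j ≡ f → toℕ i < toℕ j → e ≺ f
  ordered {i} {j} refl refl i<j = lookup-AllPairs sorted i j i<j

  edge-at : ∀ {i e} → lookup edgeList i ≡ e → IsEdge e
  edge-at {i} refl = isEdge i

  -- Edges sharing a right end give `c - a = Y - X < Y` and `c - e = Z - W`. Since `Z - W ≥ Y`, this
  -- forces `e < a`.
  no-pattern : ∀ {a b c d e} → IsEdge (a , b) → IsEdge (c , b) → IsEdge (c , d) → IsEdge (e , d) →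
    toℕ a < toℕ e → toℕ e < toℕ c → ¬ d Fin.< b
  no-pattern {a} {b} {c} {d} {e} ab cb cd ed a<e e<c d<b = <-asym a<e (+-cancelʳ-< Y (toℕ e) (toℕ a) (begin-strict
    toℕ e + Y   ≤⟨ e+Y≤c ⟩
    toℕ c       <⟨ m<m+n (toℕ c) (m^n>0 2 (exponent ab)) ⟩
    toℕ c + X   ≡⟨ cross {b} {a} {c} (equation ab) (equation cb) ⟩
    toℕ a + Y   ∎))
    where
    open ≤-Reasoning
    X = 2 ^ exponent ab
    Y = 2 ^ exponent cb
    Z = 2 ^ exponent cd
    W = 2 ^ exponent ed
    cross : ∀ {y x x′ : Fin n} {p p′} → toℕ y + p ≡ M + M + toℕ x → toℕ y + p′ ≡ M + M + toℕ x′ →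
      toℕ x′ + p ≡ toℕ x + p′
    cross {y} {x} {x′} {p} {p′} eq eq′ = +-cancelˡ-≡ (M + M + toℕ y) _ _ (begin-equality
      M + M + toℕ y + (toℕ x′ + p)     ≡⟨ swap₁ (M + M) (toℕ y) (toℕ x′) p ⟩
      (M + M + toℕ x′) + (toℕ y + p)   ≡⟨ cong₂ _+_ (sym eq′) eq ⟩
      (toℕ y + p′) + (M + M + toℕ x)   ≡⟨ swap₂ (M + M) (toℕ y) (toℕ x) p′ ⟩
      M + M + toℕ y + (toℕ x + p′)     ∎)
      where
      swap₁ : ∀ m y x p → m + y + (x + p) ≡ (m + x) + (y + p)
      swap₁ = solve-∀
      swap₂ : ∀ m y x p → (y + p) + (m + x) ≡ m + y + (x + p)
      swap₂ = solve-∀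
    c+W≡e+Z : toℕ c + W ≡ toℕ e + Z
    c+W≡e+Z = cross {d} {e} {c} (equation ed) (equation cd)
    W<Z : W < Z
    W<Z = +-cancelˡ-< (toℕ e) W Z (subst (toℕ e + W <_) c+W≡e+Z (+-monoˡ-< W e<c))
    Y<Z : Y < Z
    Y<Z = ≰⇒> λ Z≤Y → <⇒≢ (+-mono-<-≤ d<b Z≤Y) (trans (equation cd) (sym (equation cb)))
    -- `Y` and `W` are powers of two below the power `Z`, hence each at most half of it.
    Y+W≤Z : Y + W ≤ Z
    Y+W≤Z = *-cancelˡ-≤ 2 (begin
      2 * (Y + W)     ≡⟨ *-distribˡ-+ 2 Y W ⟩
      2 * Y + 2 * W   ≤⟨ +-mono-≤ (2*2^m≤2^n {exponent cb} {exponent cd} Y<Z) (2*2^m≤2^n {exponent ed} {exponent cd} W<Z) ⟩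
      Z + Z           ≡⟨ cong (Z +_) (+-identityʳ Z) ⟨
      2 * Z           ∎)
    e+Y≤c : toℕ e + Y ≤ toℕ c
    e+Y≤c = +-cancelʳ-≤ W _ _ (begin
      toℕ e + Y + W     ≡⟨ +-assoc (toℕ e) Y W ⟩
      toℕ e + (Y + W)   ≤⟨ +-monoʳ-≤ (toℕ e) Y+W≤Z ⟩
      toℕ e + Z         ≡⟨ c+W≡e+Z ⟨
      toℕ c + W         ∎)

  graph-free : P5-1432-free graph
  graph-free (v , v-inj , i₁ , i₂ , i₃ , i₄ , e₁ , e₂ , e₃ , e₄ , 1<4 , 4<3 , 3<2) with toℕ (v 1F) <? M
  -- Here `v 1F` and `v 3F` are left ends: `i₁ < i₄` gives `v 1F ≤ v 3F`, and `i₃ < i₂` gives the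
  -- converse.
  ... | yes v₁<M = Fin.0≢1+n (Fin.suc-injective (v-inj (Fin.toℕ-injective (≤-antisym
      (≺⇒≤ (ordered p₁ p₄ 1<4)) (≺⇒≤ (ordered p₃ p₂ 3<2))))))
    where
    p₁ = pairAt (edgeAt-sym graph {i₁} e₁) v₁<M
    p₂ = pairAt e₂ v₁<M
    p₃ = pairAt′ e₃ (right (edge-at p₂))
    p₄ = pairAt e₄ (left (edge-at p₃))
  -- The left ends are now `v 0F`, `v 2F`, `v 4F`; the edges `i₃` and `i₂` share `v 2F`, so their
  -- order is that of the right ends.
  ... | no v₁≮M = no-pattern (edge-at p₁) (edge-at p₂) (edge-at p₃) (edge-at p₄)
      (≤∧≢⇒< (≺⇒≤ (ordered p₁ p₄ 1<4)) λ eq → Fin.0≢1+n (v-inj (Fin.toℕ-injective eq)))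
      (≤∧≢⇒< (≺⇒≤ (ordered p₄ p₃ 4<3)) λ eq →
        Fin.0≢1+n (Fin.suc-injective (Fin.suc-injective (sym (v-inj (Fin.toℕ-injective eq))))))
      (d<b (ordered p₃ p₂ 3<2))
    where
    p₁ = pairAt′ (edgeAt-sym graph {i₁} e₁) (≮⇒≥ v₁≮M)
    p₂ = pairAt′ e₂ (≮⇒≥ v₁≮M)
    p₃ = pairAt e₃ (left (edge-at p₂))
    p₄ = pairAt′ e₄ (right (edge-at p₃))
    d<b : (v 2F , v 3F) ≺ (v 2F , v 1F) → v 3F Fin.< v 1F
    d<b (inj₁ lt)       = contradiction lt (<-irrefl refl)
    d<b (inj₂ (_ , lt)) = lt

lower-bound : ∀ n → 4 ≤ n → Σ (EOGraph n) λ G → P5-1432-free G × n * ⌊log₂ n ⌋ ≤ 28 * ∣E∣ G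
lower-bound n 4≤n = graph , graph-free , (begin
  n * ⌊log₂ n ⌋                ≤⟨ *-mono-≤ n≤8M log≤ ⟩
  8 * 2 ^ L * (2 * suc L)      ≡⟨ regroup (2 ^ L) (suc L) ⟩
  16 * (2 ^ L * suc L)         ≡⟨ cong (16 *_) ∣E∣-graph ⟨
  -- Weakened from 16 so that one constant serves both bounds.
  16 * ∣E∣ graph               ≤⟨ *-monoˡ-≤ (∣E∣ graph) (m≤m+n 16 12) ⟩
  28 * ∣E∣ graph               ∎)
  where
  open ≤-Reasoning
  -- This gives `4 * 2 ^ L ≤ n < 8 * 2 ^ L`, which leaves room for the `3 * 2 ^ L` vertices of the
  -- construction.
  L = ⌊log₂ n ⌋ ∸ 2
  2+L≡ : 2 + L ≡ ⌊log₂ n ⌋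
  2+L≡ = m+[n∸m]≡n (⌊log₂⌋-mono-≤ {4} 4≤n)
  4*x : ∀ x → x + x + x + x ≡ 2 * (2 * x)
  4*x = solve-∀
  8*x : ∀ x → 2 * (2 * (2 * x)) ≡ 8 * x
  8*x = solve-∀
  regroup : ∀ x y → 8 * x * (2 * y) ≡ 16 * (x * y)
  regroup = solve-∀
  3M≤n : 2 ^ L + 2 ^ L + 2 ^ L ≤ n
  3M≤n = begin
    2 ^ L + 2 ^ L + 2 ^ L           ≤⟨ m≤m+n _ (2 ^ L) ⟩
    2 ^ L + 2 ^ L + 2 ^ L + 2 ^ L   ≡⟨ 4*x (2 ^ L) ⟩
    2 ^ (2 + L)                     ≡⟨ cong (2 ^_) 2+L≡ ⟩
    2 ^ ⌊log₂ n ⌋                   ≤⟨ 2^⌊log₂n⌋≤n n (≤-trans (s≤s z≤n) 4≤n) ⟩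
    n                               ∎
  n≤8M : n ≤ 8 * 2 ^ L
  n≤8M = begin
    n                               ≤⟨ <⇒≤ (n<2^[1+⌊log₂n⌋] n) ⟩
    2 ^ (1 + ⌊log₂ n ⌋)             ≡⟨ cong (λ k → 2 ^ (1 + k)) 2+L≡ ⟨
    2 ^ (3 + L)                     ≡⟨ 8*x (2 ^ L) ⟩
    8 * 2 ^ L                       ∎
  log≤ : ⌊log₂ n ⌋ ≤ 2 * suc L
  log≤ = begin
    ⌊log₂ n ⌋     ≡⟨ 2+L≡ ⟨
    2 + L         ≤⟨ +-monoʳ-≤ 2 (m≤m+n L (L + 0)) ⟩
    2 + 2 * L     ≡⟨ *-suc 2 L ⟨
    2 * suc L     ∎
  open Construction n L 3M≤n

theorem4p12 : ∃[ C ] ∃[ n₀ ] ((n : ℕ) → n ≥ n₀ →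
    ((G : EOGraph n) → P5-1432-free G → ∣E∣ G ≤ C * (n * ⌊log₂ n ⌋))
    × (Σ (EOGraph n) λ G → P5-1432-free G × n * ⌊log₂ n ⌋ ≤ C * ∣E∣ G))
theorem4p12 = 28 , 4 , λ n 4≤n → upper-bound n 4≤n , lower-bound n 4≤n
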